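{- For every integer $c\ge2$, there is an oriented graph $H_c$ of order $N=7c-1$ with $\delta^0(H_c)=2c$ (so that $7\delta^0(H_c)=2N+2$) and distinct vertices $x,y$ of $H_c$ such that no directed path from $x$ to $y$ has length $3$, $4$, or $5$. Consequently, the statement "if an oriented graph $H$ of order $N$ has $d=\delta^0(H)\ge3$ and $7d\ge2N+2$, then every ordered pair of distinct vertices is joined by a directed path of length $3$, $4$, or $5$" is false. Moreover, there are no real constants $\gamma<21$ and $K$ such that the following holds for every positive integer $C$: whenever $H$ is an oriented graph of order $N\ge\gamma C+K$ with $\delta^0(H)\ge\frac N3-C+1$, every ordered pair of distinct vertices of $H$ is joined by a directed path of length $3$, $4$, or $5$.
   Context: An oriented graph is an orientation of a (finite) simple graph: no loops, and at most one arc on each unordered pair of vertices. $\delta^0(H)=\min_{v}\min\{d^+(v),d^-(v)\}$ is the minimum semidegree. Paths are directed and simple (no repeated vertices), and the length is the number of arcs. An ordered pair $(x,y)$ is joined by a path if there is a directed path from $x$ to $y$. -}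

module Defs where

open import Data.Fin using (Fin; zero; suc; inject₁; fromℕ)
open import Data.Integer using (+_)
open import Data.List using (length; filter; map; allFin)
open import Data.List.Extrema.Nat using (min)
open import Data.Nat as ℕ using (ℕ; _⊓_)
import Data.Nat.Properties as ℕ
open import Data.Product using (_×_; _,_; ∃-syntax)
open import Data.Rational as ℚ using (ℚ; 0ℚ; ½; ∣_∣)
import Data.Rational.Properties as ℚ
open import Data.Rational.Solver using (module +-*-Solver)
open import Data.Sum using (_⊎_)
open import Function.Definitions using (Injective)
open import Level using (0ℓ)
open import Relation.Binary.Core using (Rel)
open import Relation.Binary.Definitions using (Irreflexive; Asymmetric; Decidable)
open import Relation.Binary.PropositionalEquality
  using (_≡_; _≢_; refl; sym; trans; cong; subst)
open import Relation.Nullary using (¬_)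

record OrientedGraph (n : ℕ) : Set₁ where
  field
    _⟶_      : Rel (Fin n) 0ℓ
    _⟶?_     : Decidable _⟶_
    loopless : Irreflexive _≡_ _⟶_
    oriented : Asymmetric _⟶_

module _ {n : ℕ} (H : OrientedGraph n) where
  open OrientedGraph H

  d⁺ : Fin n → ℕ
  d⁺ v = length (filter (λ u → v ⟶? u) (allFin n))

  d⁻ : Fin n → ℕ
  d⁻ v = length (filter (λ u → u ⟶? v) (allFin n))

  -- `min n xs` is the minimum of n and the entries of xs.  Every degree is at
  -- most n, so the extra n is harmless; it only gives the value 0 to the
  -- graph without vertices.
  δ⁰ : ℕ
  δ⁰ = min n (map (λ v → d⁺ v ⊓ d⁻ v) (allFin n))

  record Path (x y : Fin n) (ℓ : ℕ) : Set where
    field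
      vertex : Fin (ℕ.suc ℓ) → Fin n
      start  : vertex zero ≡ x
      end    : vertex (fromℕ ℓ) ≡ y
      arc    : (i : Fin ℓ) → vertex (inject₁ i) ⟶ vertex (suc i)
      simple : Injective _≡_ _≡_ vertex

  Joined345 : Fin n → Fin n → Set
  Joined345 x y = Path x y 3 ⊎ Path x y 4 ⊎ Path x y 5

  AllPairsJoined345 : Set
  AllPairsJoined345 = (x y : Fin n) → x ≢ y → Joined345 x y

-- Real numbers, as Cauchy sequences of rationals.  Equality of reals is not
-- needed, so no quotient is taken; the order respects it.

fromℕℚ : ℕ → ℚ
fromℕℚ n = + n ℚ./ 1

record ℝ : Set where
  field
    seq    : ℕ → ℚ
    cauchy : (ε : ℚ) → 0ℚ ℚ.< ε →
             ∃[ M ] ((m n : ℕ) → M ℕ.≤ m → M ℕ.≤ n → ∣ seq m ℚ.- seq n ∣ ℚ.< ε)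

open ℝ public

fromℕᴿ : ℕ → ℝ
fromℕᴿ k .seq _ = fromℕℚ k
fromℕᴿ k .cauchy ε 0<ε =
  0 , λ _ _ _ _ → subst (ℚ._< ε) (sym (cong ∣_∣ (ℚ.+-inverseʳ (fromℕℚ k)))) 0<ε

infixl 6 _+ᴿ_
infixr 7 _·ᴿ_
infix  4 _<ᴿ_ _≤ᴿ_

_+ᴿ_ : ℝ → ℝ → ℝ
(a +ᴿ b) .seq n = a .seq n ℚ.+ b .seq n
(a +ᴿ b) .cauchy ε 0<ε
  with a .cauchy (½ ℚ.* ε) 0<ε/2 | b .cauchy (½ ℚ.* ε) 0<ε/2
  where
  0<ε/2 : 0ℚ ℚ.< ½ ℚ.* ε
  0<ε/2 = subst (ℚ._< ½ ℚ.* ε) (ℚ.*-zeroʳ ½) (ℚ.*-monoʳ-<-pos ½ 0<ε)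
... | M₁ , close₁ | M₂ , close₂ = M₁ ℕ.⊔ M₂ , λ m n M≤m M≤n →
  let
    Δa = a .seq m ℚ.- a .seq n
    Δb = b .seq m ℚ.- b .seq n
  in
  ℚ.<-respˡ-≡ (cong ∣_∣ (sym (rearrange (a .seq m) (b .seq m) (a .seq n) (b .seq n))))
    (ℚ.≤-<-trans (ℚ.∣p+q∣≤∣p∣+∣q∣ Δa Δb)
      (subst (∣ Δa ∣ ℚ.+ ∣ Δb ∣ ℚ.<_) halves
        (ℚ.+-mono-<
          (close₁ m n (ℕ.m⊔n≤o⇒m≤o M₁ M₂ M≤m) (ℕ.m⊔n≤o⇒m≤o M₁ M₂ M≤n))
          (close₂ m n (ℕ.m⊔n≤o⇒n≤o M₁ M₂ M≤m) (ℕ.m⊔n≤o⇒n≤o M₁ M₂ M≤n)))))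
  where
  open +-*-Solver
  rearrange : ∀ p q r s → (p ℚ.+ q) ℚ.- (r ℚ.+ s) ≡ (p ℚ.- r) ℚ.+ (q ℚ.- s)
  rearrange = solve 4 (λ p q r s → (p :+ q) :- (r :+ s) := (p :- r) :+ (q :- s)) refl
  halves : ½ ℚ.* ε ℚ.+ ½ ℚ.* ε ≡ ε
  halves = trans (sym (ℚ.*-distribʳ-+ ε ½ ½)) (ℚ.*-identityˡ ε)

_·ᴿ_ : ℕ → ℝ → ℝ
ℕ.zero  ·ᴿ a = fromℕᴿ 0
ℕ.suc k ·ᴿ a = a +ᴿ k ·ᴿ a

_<ᴿ_ : ℝ → ℝ → Set
a <ᴿ b = ∃[ ε ] (0ℚ ℚ.< ε × ∃[ M ] ((n : ℕ) → M ℕ.≤ n → a .seq n ℚ.+ ε ℚ.≤ b .seq n))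

_≤ᴿ_ : ℝ → ℝ → Set
a ≤ᴿ b = ¬ (b <ᴿ a)

{-# OPTIONS --safe #-}

-- For c = k + 1 put n = 2c − 1 and take vertices x, y and classes A, P, Q of size n and R of
-- size c, with all arcs
--   x → y, A;   y → P, Q, R;   A → y, P;   P → x, R;   Q → x, A;   R → x, Q
-- and regular tournaments inside P and Q.  The order is 2 + 3n + c = 7c − 1, every
-- semidegree is at least 2c, and x has outdegree 1 + n = 2c.  A path of length at least 3
-- from x to y starts with x → A and ends with A → y.  From A it continues into P and then
-- into P ∪ R, whereas A is entered only from Q and x, so such a path has length at least 6.
--
-- For the last part take c = 3C + 1, with C + 1 in the role of the constant called C in the
-- theorem: the order is N = 21(C + 1) − 15 and N / 3 − (C + 1) + 1 = 2c, so the hypothesis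
-- on δ⁰ holds with equality.  If γ + ε ≤ 21, then N ≥ γ(C + 1) + K once ε C ≥ 15 + b, where b is
-- an eventual upper bound of the Cauchy sequence K.

module Submission where

open import Defs
open import Data.Fin using (Fin)
open import Data.Integer using (+_)
open import Data.Nat using (ℕ; _+_; _*_; _∸_; _≤_)
open import Data.Product using (_×_; Σ-syntax; ∃-syntax)
import Data.Rational as ℚ
open import Relation.Binary.PropositionalEquality using (_≡_; _≢_)
open import Relation.Nullary using (¬_)

open import Data.Bool using (Bool; true; false; not; T; T?)
open import Data.Empty using (⊥)
open import Data.Fin using (zero; suc; toℕ; splitAt; _↑ˡ_; _↑ʳ_; inject₁; fromℕ; #_)
open import Data.Fin.Properties using (splitAt-↑ˡ; splitAt-↑ʳ)
import Data.Integer as ℤ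
import Data.Integer.Properties as ℤ
import Data.Integer.Tactic.RingSolver as ℤ
open import Data.List using (length; filter; tabulate; map; allFin)
open import Data.List.Extrema.Nat using (min≤v⁺; v≤min⁺)
open import Data.List.Membership.Propositional using (lose)
open import Data.List.Membership.Propositional.Properties using (∈-map⁺; ∈-allFin)
import Data.List.Relation.Unary.All.Properties as All
open import Data.Nat using (zero; suc; z≤n; s≤s; _⊔_; _⊓_)
open import Data.Nat.Properties
  using (≤-refl; ≤-reflexive; ≤-trans; ≤-antisym; m≤m+n; m≤n+m; n≤1+n;
         +-identityʳ; +-assoc; *-comm; ⊓-glb; m⊓n≤m; m≤m⊔n; m≤n⊔m; m≤m*n)
open import Data.Nat.Tactic.RingSolver using (solve-∀)
open import Data.Product using (_,_)
import Data.Rational.Properties as ℚ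
open import Data.Rational.Solver using (module +-*-Solver)
import Data.Rational.Unnormalised as ℚᵘ
import Data.Rational.Unnormalised.Properties as ℚᵘ
open import Data.Sum using ([_,_]′; inj₁; inj₂)
open import Function using (_∘_; id)
open import Relation.Binary.PropositionalEquality
  using (refl; sym; trans; cong; cong₂; subst; _≗_; module ≡-Reasoning)

-- Counting with Boolean predicates, and degrees as counts.

bit : Bool → ℕ
bit false = 0
bit true  = 1

count : ∀ {n} → (Fin n → Bool) → ℕ
count {zero}  b = 0
count {suc n} b = bit (b zero) + count (b ∘ suc)

-- `allFin` is `tabulate id`, but the induction needs an arbitrary `f`, since the tail of the list
-- is tabulated from `f ∘ suc`.
length-filter-tabulate : ∀ {A : Set} {n} (b : A → Bool) (f : Fin n → A) →
                         length (filter (T? ∘ b) (tabulate f)) ≡ count (b ∘ f)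
length-filter-tabulate {n = zero}  b f = refl
length-filter-tabulate {n = suc n} b f with b (f zero)
... | true  = cong suc (length-filter-tabulate b (f ∘ suc))
... | false = length-filter-tabulate b (f ∘ suc)

count-cong : ∀ {n} {b b′ : Fin n → Bool} → b ≗ b′ → count b ≡ count b′
count-cong {zero}  b≗b′ = refl
count-cong {suc n} b≗b′ = cong₂ _+_ (cong bit (b≗b′ zero)) (count-cong (b≗b′ ∘ suc))

count-true : ∀ n → count {n} (λ _ → true) ≡ n
count-true zero    = refl
count-true (suc n) = cong suc (count-true n)

count-false : ∀ n → count {n} (λ _ → false) ≡ 0
count-false zero    = refl
count-false (suc n) = count-false n

count-+ : ∀ m {n} (b : Fin (m + n) → Bool) →
          count b ≡ count (b ∘ (_↑ˡ n)) + count (b ∘ (m ↑ʳ_))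
count-+ zero    b = refl
count-+ (suc m) b =
  trans (cong (λ s → bit (b zero) + s) (count-+ m (b ∘ suc))) (sym (+-assoc (bit (b zero)) _ _))

-- Peels one class off a count: `label` is a nest of such case distinctions, and `count-label`
-- applies this once per `splitAt`.
count-splitAt : ∀ {A : Set} {m n} (b : A → Bool) (f : Fin m → A) (g : Fin n → A) →
                count (b ∘ [ f , g ]′ ∘ splitAt m) ≡ count (b ∘ f) + count (b ∘ g)
count-splitAt {m = m} {n} b f g = trans (count-+ m _) (cong₂ _+_
  (count-cong λ i → cong (b ∘ [ f , g ]′) (splitAt-↑ˡ m i n))
  (count-cong λ j → cong (b ∘ [ f , g ]′) (splitAt-↑ʳ m n j)))

δ⁰≡ : ∀ {n} (H : OrientedGraph n) {d} v → d⁺ H v ≡ d →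
      (∀ u → d ≤ d⁺ H u) → (∀ u → d ≤ d⁻ H u) → d ≤ n → δ⁰ H ≡ d
δ⁰≡ {n} H v d⁺v≡d d≤d⁺ d≤d⁻ d≤n = ≤-antisym
  (min≤v⁺ n semidegrees (inj₂ (lose (∈-map⁺ semidegree (∈-allFin v))
    (≤-trans (m⊓n≤m (d⁺ H v) (d⁻ H v)) (≤-reflexive d⁺v≡d)))))
  -- `min` starts from the default value `n`, so the lower bound has to hold for it as well.
  (v≤min⁺ d≤n (All.map⁺ (All.tabulate⁺ λ u → ⊓-glb (d≤d⁺ u) (d≤d⁻ u))))
  where
  semidegree  = λ u → d⁺ H u ⊓ d⁻ H u
  semidegrees = map semidegree (allFin n)

-- Parity and the outdegrees of the rotational tournament.

even : ℕ → Bool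
even 0             = true
even 1             = false
even (suc (suc n)) = even n

even-suc : ∀ n → even (suc n) ≡ not (even n)
even-suc 0             = refl
even-suc 1             = refl
even-suc (suc (suc n)) = even-suc n

T-not : ∀ b → T b → T (not b) → ⊥
T-not true _ ()

infix 4 _≻_

-- On Fin (2k+1) this is the rotational tournament i ≻ i + 1, i + 3, …, i + (2k−1) mod 2k+1.
_≻_ : ∀ {n} → Fin n → Fin n → Bool
zero  ≻ zero  = false
zero  ≻ suc j = even (toℕ j)
suc i ≻ zero  = not (even (toℕ i))
suc i ≻ suc j = i ≻ j

≻-asym : ∀ {n} (i j : Fin n) → T (i ≻ j) → T (j ≻ i) → ⊥
≻-asym zero    (suc j) i≻j j≻i = T-not (even (toℕ j)) i≻j j≻i
≻-asym (suc i) zero    i≻j j≻i = T-not (even (toℕ i)) j≻i i≻j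
≻-asym (suc i) (suc j) i≻j j≻i = ≻-asym i j i≻j j≻i

count-even-2k : ∀ k → count {k * 2} (even ∘ toℕ) ≡ k
count-even-2k zero    = refl
count-even-2k (suc k) = cong suc (count-even-2k k)

count-even-2k+1 : ∀ k → count {suc (k * 2)} (even ∘ toℕ) ≡ suc k
count-even-2k+1 zero    = refl
count-even-2k+1 (suc k) = cong suc (count-even-2k+1 k)

-- Vertices 0 and 1 are counted directly. Deleting both leaves the same tournament on two vertices
-- fewer, and by parity every other vertex beats exactly one of them.
≻-outdegree : ∀ k (i : Fin (suc (k * 2))) → count (i ≻_) ≡ k
≻-outdegree k       zero          = count-even-2k k
≻-outdegree (suc k) (suc zero)    = count-even-2k+1 k
≻-outdegree (suc k) (suc (suc i)) rewrite ≻-outdegree k i | even-suc (toℕ i)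
  with even (toℕ i)
... | true  = refl
... | false = refl

-- Arithmetic of the order 7c - 1.

order : ℕ → ℕ
order k = let n = suc (k * 2) in suc (suc (n + (n + (n + suc k))))

order≡6+7k : ∀ k → order k ≡ 6 + k * 7
order≡6+7k = go
  where
  go : ∀ k → 2 + ((1 + k * 2) + ((1 + k * 2) + ((1 + k * 2) + (1 + k)))) ≡ 6 + k * 7
  go = solve-∀

7[2c]≡2N+2 : ∀ k → 7 * (2 * suc k) ≡ 2 * order k + 2
7[2c]≡2N+2 k = trans (go k) (cong (λ N → 2 * N + 2) (sym (order≡6+7k k)))
  where
  go : ∀ k → 7 * (2 * (1 + k)) ≡ 2 * (6 + k * 7) + 2
  go = solve-∀

N+15≡[1+C]21 : ∀ C → order (C * 3) + 15 ≡ suc C * 21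
N+15≡[1+C]21 C = trans (cong (λ N → N + 15) (order≡6+7k (C * 3))) (go C)
  where
  go : ∀ C → 6 + C * 3 * 7 + 15 ≡ (1 + C) * 21
  go = solve-∀

-- The choice c = 3C + 1 makes 7c - 1 a multiple of 3, so that N / 3 is an integer and the condition
-- on `δ⁰` becomes an identity in ℕ.
N≡3[2c+C] : ∀ C → order (C * 3) ≡ 3 * (2 * suc (C * 3) + C)
N≡3[2c+C] C = trans (order≡6+7k (C * 3)) (go C)
  where
  go : ∀ C → 6 + C * 3 * 7 ≡ 3 * (2 * (1 + C * 3) + C)
  go = solve-∀

-- The oriented graph and its semidegrees.

module Construction (k : ℕ) where

  c n N : ℕ
  c = suc k
  n = suc (k * 2)
  N = order k

  data Vertex : Set where
    x y   : Vertex
    a p q : Fin n → Vertex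
    r     : Fin c → Vertex

  infix 4 _⇒_

  _⇒_ : Vertex → Vertex → Bool
  x   ⇒ y   = true
  x   ⇒ a _ = true
  y   ⇒ p _ = true
  y   ⇒ q _ = true
  y   ⇒ r _ = true
  a _ ⇒ y   = true
  a _ ⇒ p _ = true
  p _ ⇒ x   = true
  p i ⇒ p j = i ≻ j
  p _ ⇒ r _ = true
  q _ ⇒ x   = true
  q _ ⇒ a _ = true
  -- Reversed compared with P, so that the indegree of `q i` inside Q is an outdegree of `_≻_`, as
  -- computed by `≻-outdegree`.
  q i ⇒ q j = j ≻ i
  r _ ⇒ x   = true
  r _ ⇒ q _ = true
  _   ⇒ _   = false

  ⇒-asym : ∀ u v → T (u ⇒ v) → T (v ⇒ u) → ⊥
  ⇒-asym x     y     _ ()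
  ⇒-asym x     (a _) _ ()
  ⇒-asym y     (p _) _ ()
  ⇒-asym y     (q _) _ ()
  ⇒-asym y     (r _) _ ()
  ⇒-asym (a _) y     _ ()
  ⇒-asym (a _) (p _) _ ()
  ⇒-asym (p _) x     _ ()
  ⇒-asym (p i) (p j) i⇒j j⇒i = ≻-asym i j i⇒j j⇒i
  ⇒-asym (p _) (r _) _ ()
  ⇒-asym (q _) x     _ ()
  ⇒-asym (q _) (a _) _ ()
  ⇒-asym (q i) (q j) i⇒j j⇒i = ≻-asym i j j⇒i i⇒j
  ⇒-asym (r _) x     _ ()
  ⇒-asym (r _) (q _) _ ()

  label : Fin N → Vertex
  label zero          = x
  label (suc zero)    = y
  label (suc (suc i)) =
    [ a , [ p , [ q , r ]′ ∘ splitAt n ]′ ∘ splitAt n ]′ (splitAt n i)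

  -- Lets simplicity of a path act on labels: a vertex labelled `x` or `y` is the endpoint itself,
  -- so an interior vertex of a path from x to y has neither label.
  label≡x : ∀ i → label i ≡ x → i ≡ zero
  label≡x zero _ = refl
  label≡x (suc (suc i)) eq with splitAt n i
  ... | inj₂ j with splitAt n j
  ...   | inj₂ l with splitAt n l
  label≡x (suc (suc i)) () | inj₂ j | inj₂ l | inj₁ _
  label≡x (suc (suc i)) () | inj₂ j | inj₂ l | inj₂ _

  label≡y : ∀ i → label i ≡ y → i ≡ suc zero
  label≡y (suc zero) _ = refl
  label≡y (suc (suc i)) eq with splitAt n i
  ... | inj₂ j with splitAt n j
  ...   | inj₂ l with splitAt n l
  label≡y (suc (suc i)) () | inj₂ j | inj₂ l | inj₁ _
  label≡y (suc (suc i)) () | inj₂ j | inj₂ l | inj₂ _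

  H : OrientedGraph N
  H = record
    { _⟶_      = λ u v → T (label u ⇒ label v)
    ; _⟶?_     = λ u v → T? (label u ⇒ label v)
    -- A loop would be a pair of opposite arcs.
    ; loopless = λ { {u} refl u⇒u → ⇒-asym (label u) (label u) u⇒u u⇒u }
    ; oriented = λ {u} {v} → ⇒-asym (label u) (label v)
    }

  count-label : ∀ (b : Vertex → Bool) → count (b ∘ label) ≡
    bit (b x) + (bit (b y) + (count (b ∘ a) + (count (b ∘ p) + (count (b ∘ q) + count (b ∘ r)))))
  count-label b = cong (λ s → bit (b x) + (bit (b y) + s))
    (trans (count-splitAt b a _) (cong (λ s → count (b ∘ a) + s)
      (trans (count-splitAt b p _) (cong (λ s → count (b ∘ p) + s) (count-splitAt b q r)))))

  2c≡1+n : 2 * c ≡ suc n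
  -- `c * 2` computes to `suc n`.
  2c≡1+n = *-comm 2 c

  -- The rewrites below mention k * 2 and k, not n and c, because count unfolds once on
  -- Fin (suc _).
  count-x⇒ : count ((x ⇒_) ∘ label) ≡ suc n
  count-x⇒ rewrite count-label (x ⇒_) | count-true (k * 2) | count-false (k * 2) | count-false k =
    cong (λ m → suc (suc m)) (+-identityʳ (k * 2))

  -- For the outdegree of y and the indegree of x, where the neighbours are P, Q and R.
  1+n≤2n+c : suc n ≤ n + (n + c)
  1+n≤2n+c = s≤s (≤-trans (m≤m+n n c) (m≤n+m (n + c) (k * 2)))

  -- For outdegrees in P and indegrees in Q, with equality: one neighbour among x and y, `k` in the
  -- own class, and all of R.
  1+n≤k+1+c : suc n ≤ suc (k + c)
  1+n≤k+1+c = ≤-reflexive (trans (*-comm c 2) (cong (λ m → c + m) (+-identityʳ c)))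

  1+n≤count⇒ : ∀ v → suc n ≤ count ((v ⇒_) ∘ label)
  1+n≤count⇒ x = ≤-reflexive (sym count-x⇒)
  1+n≤count⇒ y rewrite count-label (y ⇒_) | count-true (k * 2) | count-false (k * 2) | count-true k = 1+n≤2n+c
  1+n≤count⇒ (a i) rewrite count-label (a i ⇒_) | count-true (k * 2) | count-false (k * 2) = m≤m+n (suc n) _
  1+n≤count⇒ (p i) rewrite count-label (p i ⇒_) | ≻-outdegree k i | count-false (k * 2) | count-true k = 1+n≤k+1+c
  1+n≤count⇒ (q i) rewrite count-label (q i ⇒_) | count-true (k * 2) | count-false (k * 2) = m≤m+n (suc n) _
  1+n≤count⇒ (r i) rewrite count-label (r i ⇒_) | count-true (k * 2) | count-false (k * 2) = m≤m+n (suc n) _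

  1+n≤count⇐ : ∀ v → suc n ≤ count ((_⇒ v) ∘ label)
  1+n≤count⇐ x rewrite count-label (_⇒ x) | count-true (k * 2) | count-false (k * 2) | count-true k = 1+n≤2n+c
  1+n≤count⇐ y rewrite count-label (_⇒ y) | count-true (k * 2) | count-false (k * 2) = m≤m+n (suc n) _
  1+n≤count⇐ (a i) rewrite count-label (_⇒ a i) | count-true (k * 2) | count-false (k * 2) = m≤m+n (suc n) _
  1+n≤count⇐ (p i) rewrite count-label (_⇒ p i) | count-true (k * 2) | count-false (k * 2) = m≤m+n (suc n) _
  1+n≤count⇐ (q i) rewrite count-label (_⇒ q i) | ≻-outdegree k i | count-false (k * 2) | count-true k = 1+n≤k+1+c
  1+n≤count⇐ (r i) rewrite count-label (_⇒ r i) | count-true (k * 2) | count-false (k * 2) = m≤m+n (suc n) _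

  d⁺≡ : ∀ u → d⁺ H u ≡ count ((label u ⇒_) ∘ label)
  d⁺≡ u = length-filter-tabulate ((label u ⇒_) ∘ label) id

  d⁻≡ : ∀ u → d⁻ H u ≡ count ((_⇒ label u) ∘ label)
  d⁻≡ u = length-filter-tabulate ((_⇒ label u) ∘ label) id

  δ⁰≡2c : δ⁰ H ≡ 2 * c
  δ⁰≡2c = trans
    (δ⁰≡ H zero (trans (d⁺≡ zero) count-x⇒)
      (λ u → subst (suc n ≤_) (sym (d⁺≡ u)) (1+n≤count⇒ (label u)))
      (λ u → subst (suc n ≤_) (sym (d⁻≡ u)) (1+n≤count⇐ (label u)))
      (s≤s (≤-trans (m≤m+n n _) (n≤1+n _))))
    (sym 2c≡1+n)

  7δ⁰≡2N+2 : 7 * δ⁰ H ≡ 2 * N + 2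
  7δ⁰≡2N+2 = trans (cong (λ d → 7 * d) δ⁰≡2c) (7[2c]≡2N+2 k)

  -- Absence of short paths from x to y.

  no-walk₃ : ∀ u v → u ≢ y → T (x ⇒ u) → T (u ⇒ v) → T (v ⇒ y) → ⊥
  no-walk₃ y     _     u≢y _ _ _ = u≢y refl
  no-walk₃ (a _) y     _   _ _ ()
  no-walk₃ (a _) (p _) _   _ _ ()

  no-walk₄ : ∀ u v w → u ≢ y → v ≢ y → w ≢ x →
             T (x ⇒ u) → T (u ⇒ v) → T (v ⇒ w) → T (w ⇒ y) → ⊥
  no-walk₄ y     _     _     u≢y _   _   _ _ _ _ = u≢y refl
  no-walk₄ (a _) y     _     _   v≢y _   _ _ _ _ = v≢y refl
  no-walk₄ (a _) (p _) x     _   _   w≢x _ _ _ _ = w≢x refl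
  no-walk₄ (a _) (p _) (p _) _   _   _   _ _ _ ()
  no-walk₄ (a _) (p _) (r _) _   _   _   _ _ _ ()

  no-walk₅ : ∀ u v w t → u ≢ y → v ≢ y → w ≢ x → t ≢ x →
             T (x ⇒ u) → T (u ⇒ v) → T (v ⇒ w) → T (w ⇒ t) → T (t ⇒ y) → ⊥
  no-walk₅ y     _     _     _     u≢y _   _   _   _ _ _ _ _ = u≢y refl
  no-walk₅ (a _) y     _     _     _   v≢y _   _   _ _ _ _ _ = v≢y refl
  no-walk₅ (a _) (p _) x     _     _   _   w≢x _   _ _ _ _ _ = w≢x refl
  no-walk₅ (a _) (p _) (p _) x     _   _   _   t≢x _ _ _ _ _ = t≢x refl
  no-walk₅ (a _) (p _) (p _) (p _) _   _   _   _   _ _ _ _ ()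
  no-walk₅ (a _) (p _) (p _) (r _) _   _   _   _   _ _ _ _ ()
  no-walk₅ (a _) (p _) (r _) x     _   _   _   t≢x _ _ _ _ _ = t≢x refl
  -- The only branch that gets as far as Q: going on through A to y would give length 6.
  no-walk₅ (a _) (p _) (r _) (q _) _   _   _   _   _ _ _ _ ()

  -- The path is read through `label`, with its ends replaced by the constructors `x` and `y`, so
  -- that `_⇒_` can compute on the first and last arcs.
  module Walk {ℓ} (P : Path H zero (suc zero) (suc ℓ)) where
    open Path P

    at : Fin (suc (suc ℓ)) → Vertex
    at i = label (vertex i)

    step : ∀ i → T (at (inject₁ i) ⇒ at (suc i))
    step = arc

    first : T (x ⇒ at (suc zero))
    first = subst (λ u → T (u ⇒ at (suc zero))) (cong label start) (arc zero)

    last : T (at (inject₁ (fromℕ ℓ)) ⇒ y)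
    last = subst (λ u → T (at (inject₁ (fromℕ ℓ)) ⇒ u)) (cong label end) (arc (fromℕ ℓ))

    ≢x : ∀ i → at (suc i) ≢ x
    ≢x i eq with simple (trans (label≡x (vertex (suc i)) eq) (sym start))
    ... | ()

    ≢y : ∀ i → i ≢ fromℕ (suc ℓ) → at i ≢ y
    ≢y i i≢ℓ eq = i≢ℓ (simple (trans (label≡y (vertex i) eq) (sym end)))

  no-path₃ : ¬ Path H zero (suc zero) 3
  no-path₃ P = no-walk₃ (at (# 1)) (at (# 2))
    (≢y (# 1) λ ())
    first (step (# 1)) last
    where open Walk P

  no-path₄ : ¬ Path H zero (suc zero) 4
  no-path₄ P = no-walk₄ (at (# 1)) (at (# 2)) (at (# 3))
    (≢y (# 1) λ ()) (≢y (# 2) λ ()) (≢x (# 2))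
    first (step (# 1)) (step (# 2)) last
    where open Walk P

  no-path₅ : ¬ Path H zero (suc zero) 5
  no-path₅ P = no-walk₅ (at (# 1)) (at (# 2)) (at (# 3)) (at (# 4))
    (≢y (# 1) λ ()) (≢y (# 2) λ ()) (≢x (# 2)) (≢x (# 3))
    first (step (# 1)) (step (# 2)) (step (# 3)) last
    where open Walk P

  ¬joined : ¬ AllPairsJoined345 H
  ¬joined joined with joined zero (suc zero) (λ ())
  ... | inj₁ P        = no-path₃ P
  ... | inj₂ (inj₁ P) = no-path₄ P
  ... | inj₂ (inj₂ P) = no-path₅ P

-- Rational arithmetic and estimates for Cauchy sequences.

fromℚᵘ-+ : ∀ p q → ℚ.fromℚᵘ (p ℚᵘ.+ q) ≡ ℚ.fromℚᵘ p ℚ.+ ℚ.fromℚᵘ q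
fromℚᵘ-+ p q = ℚ.toℚᵘ-injective (begin-equality
  ℚ.toℚᵘ (ℚ.fromℚᵘ (p ℚᵘ.+ q))                       ≃⟨ ℚ.toℚᵘ-fromℚᵘ (p ℚᵘ.+ q) ⟩
  p ℚᵘ.+ q                                            ≃⟨ ℚᵘ.+-cong (ℚ.toℚᵘ-fromℚᵘ p) (ℚ.toℚᵘ-fromℚᵘ q) ⟨
  ℚ.toℚᵘ (ℚ.fromℚᵘ p) ℚᵘ.+ ℚ.toℚᵘ (ℚ.fromℚᵘ q)     ≃⟨ ℚ.toℚᵘ-homo-+ (ℚ.fromℚᵘ p) (ℚ.fromℚᵘ q) ⟨
  ℚ.toℚᵘ (ℚ.fromℚᵘ p ℚ.+ ℚ.fromℚᵘ q)                ∎)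
  where open ℚᵘ.≤-Reasoning

-- Addition in ℚ normalises its result, so the identity is checked on unnormalised fractions, where
-- cross-multiplication leaves a ring identity in ℤ.
fromℕℚ-+ : ∀ m n → fromℕℚ (m + n) ≡ fromℕℚ m ℚ.+ fromℕℚ n
fromℕℚ-+ m n = trans
  (ℚ.fromℚᵘ-cong {ℚᵘ.mkℚᵘ (+ (m + n)) 0} {ℚᵘ.mkℚᵘ (+ m) 0 ℚᵘ.+ ℚᵘ.mkℚᵘ (+ n) 0}
    (ℚᵘ.*≡* (lemma (+ m) (+ n))))
  (fromℚᵘ-+ (ℚᵘ.mkℚᵘ (+ m) 0) (ℚᵘ.mkℚᵘ (+ n) 0))
  where
  lemma : ∀ i j → (i ℤ.+ j) ℤ.* ℤ.1ℤ ≡ (i ℤ.* ℤ.1ℤ ℤ.+ j ℤ.* ℤ.1ℤ) ℤ.* ℤ.1ℤ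
  lemma = ℤ.solve-∀

[3*m]/3≡m : ∀ m → + (3 * m) ℚ./ 3 ≡ fromℕℚ m
-- `mkℚᵘ` stores the denominator minus one: 2 stands for 3, and 0 for 1.
[3*m]/3≡m m = ℚ.fromℚᵘ-cong {ℚᵘ.mkℚᵘ (+ (3 * m)) 2} {ℚᵘ.mkℚᵘ (+ m) 0} (ℚᵘ.*≡* (begin
  + (3 * m) ℤ.* ℤ.1ℤ  ≡⟨ ℤ.*-identityʳ (+ (3 * m)) ⟩
  + (3 * m)            ≡⟨ cong +_ (*-comm 3 m) ⟩
  + (m * 3)            ≡⟨ ℤ.pos-* m 3 ⟩
  + m ℤ.* + 3          ∎))
  where open ≡-Reasoning

p≤∣p∣ : ∀ p → p ℚ.≤ ℚ.∣ p ∣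
p≤∣p∣ (ℚ.mkℚ (+ _)      _ _) = ℚ.≤-refl
p≤∣p∣ (ℚ.mkℚ ℤ.-[1+ _ ] _ _) = ℚ.*≤* ℤ.-≤+

-- The denominator is at least 1, so dividing by it cannot increase a nonnegative numerator; a
-- negative `p` lies below 0.
p≤fromℕℚ∣↥p∣ : ∀ p → p ℚ.≤ fromℕℚ ℤ.∣ ℚ.↥ p ∣
p≤fromℕℚ∣↥p∣ p = ℚ.toℚᵘ-cancel-≤
  (ℚᵘ.≤-respʳ-≃ (ℚᵘ.≃-sym (ℚ.toℚᵘ-fromℚᵘ (ℚᵘ.mkℚᵘ (+ ℤ.∣ ℚ.↥ p ∣) 0))) (go p))
  where
  go : ∀ p → ℚ.toℚᵘ p ℚᵘ.≤ ℚᵘ.mkℚᵘ (+ ℤ.∣ ℚ.↥ p ∣) 0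
  go (ℚ.mkℚ (+ n) d _) = ℚᵘ.*≤* (subst (ℤ._≤ + n ℤ.* + suc d) (sym (ℤ.*-identityʳ (+ n)))
    (subst (+ n ℤ.≤_) (ℤ.pos-* n (suc d)) (ℤ.+≤+ (m≤m*n n (suc d)))))
  go (ℚ.mkℚ ℤ.-[1+ n ] d _) = ℚᵘ.*≤* ℤ.-≤+

archimedean : ∀ b {ε} → ℚ.0ℚ ℚ.< ε → ∃[ m ] b ℚ.≤ fromℕℚ m ℚ.* ε
archimedean b {ε} 0<ε = m , (begin
  b                        ≡⟨ ℚ.*-identityʳ b ⟨
  b ℚ.* ℚ.1ℚ              ≡⟨ cong (b ℚ.*_) (ℚ.*-inverseˡ ε) ⟨
  b ℚ.* (ℚ.1/ ε ℚ.* ε)    ≡⟨ ℚ.*-assoc b (ℚ.1/ ε) ε ⟨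
  b ℚ.* ℚ.1/ ε ℚ.* ε      ≤⟨ ℚ.*-monoʳ-≤-nonNeg ε (p≤fromℕℚ∣↥p∣ (b ℚ.* ℚ.1/ ε)) ⟩
  fromℕℚ m ℚ.* ε          ∎)
  where
  open ℚ.≤-Reasoning
  instance
    ε-pos : ℚ.Positive ε
    ε-pos = ℚ.positive 0<ε
    ε-nonNeg : ℚ.NonNegative ε
    ε-nonNeg = ℚ.pos⇒nonNeg ε
    ε-nonZero : ℚ.NonZero ε
    ε-nonZero = ℚ.pos⇒nonZero ε
  -- A natural number above b / ε.
  m = ℤ.∣ ℚ.↥ (b ℚ.* ℚ.1/ ε) ∣

-- From some index `M` on, all terms lie within 1 of the term at `M`.
cauchy⇒bounded : ∀ α → ∃[ M ] ∃[ b ] (∀ n → M ≤ n → seq α n ℚ.≤ b)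
cauchy⇒bounded α with α .cauchy ℚ.1ℚ (ℚ.positive⁻¹ ℚ.1ℚ)
... | M , close = M , ℚ.1ℚ ℚ.+ seq α M , λ n M≤n → begin
  seq α n                          ≡⟨ lemma (seq α n) (seq α M) ⟩
  (seq α n ℚ.- seq α M) ℚ.+ seq α M
    ≤⟨ ℚ.+-monoˡ-≤ (seq α M) (ℚ.≤-trans (p≤∣p∣ (seq α n ℚ.- seq α M)) (ℚ.<⇒≤ (close n M M≤n ≤-refl))) ⟩
  ℚ.1ℚ ℚ.+ seq α M               ∎
  where
  open ℚ.≤-Reasoning
  open +-*-Solver
  lemma : ∀ s t → s ≡ (s ℚ.- t) ℚ.+ t
  lemma = solve 2 (λ s t → s := (s :- t) :+ t) refl

fromℕℚ-suc-* : ∀ m q → fromℕℚ (suc m) ℚ.* q ≡ q ℚ.+ fromℕℚ m ℚ.* q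
fromℕℚ-suc-* m q = begin
  fromℕℚ (suc m) ℚ.* q            ≡⟨ cong (ℚ._* q) (fromℕℚ-+ 1 m) ⟩
  (ℚ.1ℚ ℚ.+ fromℕℚ m) ℚ.* q      ≡⟨ ℚ.*-distribʳ-+ q ℚ.1ℚ (fromℕℚ m) ⟩
  ℚ.1ℚ ℚ.* q ℚ.+ fromℕℚ m ℚ.* q ≡⟨ cong (ℚ._+ fromℕℚ m ℚ.* q) (ℚ.*-identityˡ q) ⟩
  q ℚ.+ fromℕℚ m ℚ.* q           ∎
  where open ≡-Reasoning

-- Adds up `C` copies of the hypothesis at the index `n`. The gap grows to `C` times `ε`, which is
-- what later absorbs the constants `e` and `b`.
·ᴿ-upper : ∀ C α d {ε n} → seq α n ℚ.+ ε ℚ.≤ fromℕℚ d →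
           seq (C ·ᴿ α) n ℚ.+ fromℕℚ C ℚ.* ε ℚ.≤ fromℕℚ (C * d)
·ᴿ-upper zero    α d {ε} _ = ℚ.≤-reflexive (trans (ℚ.+-identityˡ (ℚ.0ℚ ℚ.* ε)) (ℚ.*-zeroˡ ε))
·ᴿ-upper (suc C) α d {ε} {n} α+ε≤d = begin
  (seq α n ℚ.+ s) ℚ.+ fromℕℚ (suc C) ℚ.* ε    ≡⟨ cong ((seq α n ℚ.+ s) ℚ.+_) (fromℕℚ-suc-* C ε) ⟩
  (seq α n ℚ.+ s) ℚ.+ (ε ℚ.+ fromℕℚ C ℚ.* ε)  ≡⟨ lemma (seq α n) s ε (fromℕℚ C ℚ.* ε) ⟩
  (seq α n ℚ.+ ε) ℚ.+ (s ℚ.+ fromℕℚ C ℚ.* ε)  ≤⟨ ℚ.+-mono-≤ α+ε≤d (·ᴿ-upper C α d α+ε≤d) ⟩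
  fromℕℚ d ℚ.+ fromℕℚ (C * d)                   ≡⟨ fromℕℚ-+ d (C * d) ⟨
  fromℕℚ (suc C * d)                             ∎
  where
  open ℚ.≤-Reasoning
  open +-*-Solver
  s = seq (C ·ᴿ α) n
  lemma : ∀ p q r t → (p ℚ.+ q) ℚ.+ (r ℚ.+ t) ≡ (p ℚ.+ r) ℚ.+ (q ℚ.+ t)
  lemma = solve 4 (λ p q r t → (p :+ q) :+ (r :+ t) := (p :+ r) :+ (q :+ t)) refl

-- N / 3 is the integer d + C, and the final + 1 cancels the successor in `suc C`.
semidegree-condition : ∀ N C d → N ≡ 3 * (d + C) →
                       ((+ N ℚ./ 3) ℚ.- fromℕℚ (suc C)) ℚ.+ ℚ.1ℚ ℚ.≤ fromℕℚ d
semidegree-condition N C d refl = ℚ.≤-reflexive (begin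
  ((+ (3 * (d + C)) ℚ./ 3) ℚ.- fromℕℚ (suc C)) ℚ.+ ℚ.1ℚ
    ≡⟨ cong₂ (λ s t → (s ℚ.- t) ℚ.+ ℚ.1ℚ)
         (trans ([3*m]/3≡m (d + C)) (fromℕℚ-+ d C)) (fromℕℚ-+ 1 C) ⟩
  ((fromℕℚ d ℚ.+ fromℕℚ C) ℚ.- (ℚ.1ℚ ℚ.+ fromℕℚ C)) ℚ.+ ℚ.1ℚ
    ≡⟨ lemma (fromℕℚ d) (fromℕℚ C) ⟩
  fromℕℚ d ∎)
  where
  open ≡-Reasoning
  open +-*-Solver
  lemma : ∀ s t → ((s ℚ.+ t) ℚ.- (ℚ.1ℚ ℚ.+ t)) ℚ.+ ℚ.1ℚ ≡ s
  lemma = solve 2 (λ s t → ((s :+ t) :- (con ℚ.1ℚ :+ t)) :+ con ℚ.1ℚ := s) refl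

order-condition : ∀ N C d e → N + e ≡ suc C * d → ∀ γ K {ε b M} → ℚ.0ℚ ℚ.< ε →
  (∀ n → M ≤ n → seq γ n ℚ.+ ε ℚ.≤ fromℕℚ d) → (∀ n → M ≤ n → seq K n ℚ.≤ b) →
  fromℕℚ e ℚ.+ b ℚ.≤ fromℕℚ C ℚ.* ε →
  (suc C ·ᴿ γ) +ᴿ K ≤ᴿ fromℕᴿ N
order-condition N C d e N+e≡[1+C]d γ K {ε} {b} {M} 0<ε γ+ε≤d K≤b e+b≤Cε (ε′ , 0<ε′ , M′ , N+ε′≤) =
  -- `_≤ᴿ_` is a negation, so the opposite strict inequality supplies `ε′`, and the chain ends where
  -- it began. It is strict because of `ε′` and of the one `ε` by which `suc C` copies exceed `C`.
  ℚ.<-irrefl refl (begin-strict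
    fromℕℚ N ℚ.+ fromℕℚ C ℚ.* ε           ≡⟨ lemma₁ (fromℕℚ N) (fromℕℚ C ℚ.* ε) ⟩
    (fromℕℚ N ℚ.+ ℚ.0ℚ) ℚ.+ (ℚ.0ℚ ℚ.+ fromℕℚ C ℚ.* ε)
      <⟨ ℚ.+-mono-< (ℚ.+-monoʳ-< (fromℕℚ N) 0<ε′) (ℚ.+-monoˡ-< (fromℕℚ C ℚ.* ε) 0<ε) ⟩
    (fromℕℚ N ℚ.+ ε′) ℚ.+ (ε ℚ.+ fromℕℚ C ℚ.* ε)
      ≤⟨ ℚ.+-monoˡ-≤ (ε ℚ.+ fromℕℚ C ℚ.* ε) (N+ε′≤ m (m≤n⊔m M M′)) ⟩
    (s ℚ.+ seq K m) ℚ.+ (ε ℚ.+ fromℕℚ C ℚ.* ε)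
      ≡⟨ cong ((s ℚ.+ seq K m) ℚ.+_) (fromℕℚ-suc-* C ε) ⟨
    (s ℚ.+ seq K m) ℚ.+ fromℕℚ (suc C) ℚ.* ε
      ≡⟨ lemma₂ s (seq K m) (fromℕℚ (suc C) ℚ.* ε) ⟩
    (s ℚ.+ fromℕℚ (suc C) ℚ.* ε) ℚ.+ seq K m
      ≤⟨ ℚ.+-mono-≤ (·ᴿ-upper (suc C) γ d (γ+ε≤d m (m≤m⊔n M M′))) (K≤b m (m≤m⊔n M M′)) ⟩
    fromℕℚ (suc C * d) ℚ.+ b               ≡⟨ cong (λ l → fromℕℚ l ℚ.+ b) N+e≡[1+C]d ⟨
    fromℕℚ (N + e) ℚ.+ b                   ≡⟨ cong (ℚ._+ b) (fromℕℚ-+ N e) ⟩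
    (fromℕℚ N ℚ.+ fromℕℚ e) ℚ.+ b         ≡⟨ ℚ.+-assoc (fromℕℚ N) (fromℕℚ e) b ⟩
    fromℕℚ N ℚ.+ (fromℕℚ e ℚ.+ b)         ≤⟨ ℚ.+-monoʳ-≤ (fromℕℚ N) e+b≤Cε ⟩
    fromℕℚ N ℚ.+ fromℕℚ C ℚ.* ε           ∎)
  where
  open ℚ.≤-Reasoning
  open +-*-Solver
  -- At this index the estimates for `γ` and `K` and the assumed inequality all hold.
  m = M ⊔ M′
  s = seq (suc C ·ᴿ γ) m
  lemma₁ : ∀ s t → s ℚ.+ t ≡ (s ℚ.+ ℚ.0ℚ) ℚ.+ (ℚ.0ℚ ℚ.+ t)
  lemma₁ = solve 2 (λ s t → s :+ t := (s :+ con ℚ.0ℚ) :+ (con ℚ.0ℚ :+ t)) refl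
  lemma₂ : ∀ s t u → (s ℚ.+ t) ℚ.+ u ≡ (s ℚ.+ u) ℚ.+ t
  lemma₂ = solve 3 (λ s t u → (s :+ t) :+ u := (s :+ u) :+ t) refl

-- Linear thresholds and the three claims.

Threshold : ℝ → ℝ → Set₁
Threshold γ K = (C : ℕ) → 1 ≤ C → (N : ℕ) (H : OrientedGraph N) →
  (C ·ᴿ γ) +ᴿ K ≤ᴿ fromℕᴿ N →
  ((+ N ℚ./ 3) ℚ.- fromℕℚ C) ℚ.+ ℚ.1ℚ ℚ.≤ fromℕℚ (δ⁰ H) →
  AllPairsJoined345 H

-- Keeps the real estimates apart from the graphs: member `C` of the family answers the constant
-- `suc C`, its order falls short of `d` times that constant by the fixed amount `e`, and `C` is
-- chosen only after `γ` and `K` are known.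
no-threshold : ∀ d e →
  (∀ C → ∃[ N ] Σ[ H ∈ OrientedGraph N ]
    (N + e ≡ suc C * d × N ≡ 3 * (δ⁰ H + C) × ¬ AllPairsJoined345 H)) →
  ∀ γ K → γ <ᴿ fromℕᴿ d → ¬ Threshold γ K
no-threshold d e family γ K (ε , 0<ε , M₁ , γ+ε≤d) threshold =
  let M₂ , b , K≤b = cauchy⇒bounded K
      C , e+b≤Cε = archimedean (fromℕℚ e ℚ.+ b) 0<ε
      N , H , N+e≡[1+C]d , N≡3[δ⁰+C] , ¬joined = family C
  in ¬joined (threshold (suc C) (s≤s z≤n) N H
       (order-condition N C d e N+e≡[1+C]d γ K 0<ε
         (λ n M≤n → γ+ε≤d n (≤-trans (m≤m⊔n M₁ M₂) M≤n))
         (λ n M≤n → K≤b n (≤-trans (m≤n⊔m M₁ M₂) M≤n)) e+b≤Cε)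
       (semidegree-condition N C (δ⁰ H) N≡3[δ⁰+C]))

extremal : (c : ℕ) → 2 ≤ c →
  ∃[ N ] (N ≡ 7 * c ∸ 1 ×
    Σ[ H ∈ OrientedGraph N ]
      (δ⁰ H ≡ 2 * c
       × 7 * δ⁰ H ≡ 2 * N + 2
       × Σ[ x ∈ Fin N ] Σ[ y ∈ Fin N ]
           (x ≢ y × ¬ Path H x y 3 × ¬ Path H x y 4 × ¬ Path H x y 5)))
extremal (suc k) _ = N , trans (order≡6+7k k) (cong (_∸ 1) (*-comm (suc k) 7)) ,
  H , δ⁰≡2c , 7δ⁰≡2N+2 ,
  zero , suc zero , (λ ()) , no-path₃ , no-path₄ , no-path₅
  where open Construction k

not-all-joined : ∀ k → 3 ≤ 2 * suc k →
  ¬ ((N : ℕ) (H : OrientedGraph N) → 3 ≤ δ⁰ H → 2 * N + 2 ≤ 7 * δ⁰ H → AllPairsJoined345 H)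
not-all-joined k 3≤2c all-joined =
  ¬joined (all-joined N H (subst (3 ≤_) (sym δ⁰≡2c) 3≤2c) (≤-reflexive (sym 7δ⁰≡2N+2)))
  where open Construction k

no-threshold-below-21 : ∀ γ K → γ <ᴿ fromℕᴿ 21 → ¬ Threshold γ K
no-threshold-below-21 = no-threshold 21 15 λ C → let open Construction (C * 3) in
  N , H , N+15≡[1+C]21 C , trans (N≡3[2c+C] C) (cong (λ d → 3 * (d + C)) (sym δ⁰≡2c)) , ¬joined

proposition2p4 : ((c : ℕ) → 2 ≤ c →
    ∃[ N ] (N ≡ 7 * c ∸ 1 ×
    Σ[ H ∈ OrientedGraph N ]
    (δ⁰ H ≡ 2 * c
    × 7 * δ⁰ H ≡ 2 * N + 2
    × Σ[ x ∈ Fin N ] Σ[ y ∈ Fin N ]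
    (x ≢ y × ¬ Path H x y 3 × ¬ Path H x y 4 × ¬ Path H x y 5))))
    × (¬ ((N : ℕ) (H : OrientedGraph N) →
    3 ≤ δ⁰ H → 2 * N + 2 ≤ 7 * δ⁰ H → AllPairsJoined345 H))
    × (¬ (Σ[ γ ∈ ℝ ] Σ[ K ∈ ℝ ]
    (γ <ᴿ fromℕᴿ 21
    × ((C : ℕ) → 1 ≤ C → (N : ℕ) (H : OrientedGraph N) →
    (C ·ᴿ γ) +ᴿ K ≤ᴿ fromℕᴿ N →
    ((+ N ℚ./ 3) ℚ.- fromℕℚ C) ℚ.+ ℚ.1ℚ ℚ.≤ fromℕℚ (δ⁰ H) →
    AllPairsJoined345 H))))
-- The value `k = 1`, that is c = 2, gives order 13 and minimum semidegree 4.
proposition2p4 = extremal , not-all-joined 1 (m≤m+n 3 1) ,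
  λ (γ , K , γ<21 , threshold) → no-threshold-below-21 γ K γ<21 threshold
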